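{- Let $v$ be an arbitrary nonempty word of length $m$ whose letters are positive integers (repetitions allowed), and let $n\ge m$. Then the map ${\bf F}_3$ defined below restricts to a bijection of $\mathrm{Sh}(0^{n-m}v)$ onto itself, and for every $w\in\mathrm{Sh}(0^{n-m}v)$: $$\mathrm{maj}\,w=\mathrm{mafz}\,{\bf F}_3(w),$$ and the last (rightmost) letter of $w$ equals the last letter of ${\bf F}_3(w)$.
   Context: Words have nonnegative integer letters. For $w=x_1\cdots x_n$: $\mathrm{DES}\,w=\{i:1\le i\le n-1,\ x_i>x_{i+1}\}$, $\mathrm{maj}\,w=\sum_{i\in\mathrm{DES}\,w}i$; $\mathrm{Zero}\,w=\{i:x_i=0\}$, $\mathrm{zero}\,w=\#\mathrm{Zero}\,w$; $\mathrm{Pos}\,w$ is the subword of positive letters. $\mathrm{mafz}\,w=\sum_{i\in\mathrm{Zero}\,w}i-\sum_{i=1}^{\mathrm{zero}\,w}i+\mathrm{maj}\,\mathrm{Pos}\,w$. For a word $v$ of positive integers of length $m\le n$, $\mathrm{Sh}(0^{n-m}v)$ is the set of words of length $n$ with exactly $n-m$ zeros and with $\mathrm{Pos}\,w=v$. The map ${\bf F}_3$ on all finite words with nonnegative letters is defined by induction on the length $n$. If $n\le1$, or if all letters of $w$ other than the last are $0$, then ${\bf F}_3(w)=w$. Otherwise write uniquely $w=w'a0^rb$, where $a\ge1$ is the rightmost positive letter among the first $n-1$ letters, $r\ge0$, $b\ge0$ is the last letter, and $w'$ is a (possibly empty) word. (1) If $a\le b$: ${\bf F}_3(w)={\bf F}_3(w'a0^r)\,b$.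 (2) If $a>b$ and $r\ge1$: write ${\bf F}_3(w'a0^r)=w''c$ with $c$ a letter; then ${\bf F}_3(w)=0\,w''\,b$ (i.e. add a $0$ on the left, delete the rightmost letter, which is a $0$, and append $b$). (3) If $a>b$ and $r=0$: write ${\bf F}_3(w'a)=0^{m_1}x_1v_10^{m_2}x_2v_2\cdots0^{m_k}x_kv_k$ with $m_1\ge0$, $m_2,\dots,m_k\ge1$, $x_1,\dots,x_k$ positive letters and $v_1,\dots,v_k$ (possibly empty) words of positive letters; let $\delta({\bf F}_3(w'a))=x_10^{m_1}v_1x_20^{m_2}v_2\cdots x_k0^{m_k}v_k$, and set ${\bf F}_3(w)=\delta({\bf F}_3(w'a))\,b$. -}

module Defs where

open import Data.Bool.Base using (if_then_else_)
open import Data.Integer.Base using (ℤ; +_) renaming (_+_ to _+ᶻ_; _-_ to _-ᶻ_)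
open import Data.List.Base
  using (List; []; _∷_; _++_; _∷ʳ_; length; replicate; filter; sum; map; upTo; concatMap;
          InitLast; _∷ʳ′_; initLast)
open import Data.List.Properties using (∷ʳ-injective; ++-assoc)
open import Data.List.Relation.Unary.All using (All; []; _∷_)
open import Data.List.Reverse using (Reverse; []; _∶_∶ʳ_; reverseView)
open import Data.Nat.Base using (ℕ; zero; suc; _≤_; _<_; _∸_; _+_)
open import Data.Nat.Properties using (_<?_; _≤?_; _≟_; <⇒≱; +-suc; +-identityʳ)
open import Data.Product.Base using (_×_; _,_)
open import Relation.Nullary.Decidable using (does; dec-true; dec-false)
open import Relation.Binary.PropositionalEquality
  using (_≡_; refl; sym; trans; cong; cong₂)

Word : Set
Word = List ℕ

-- DESFrom i w and ZeroFrom i w list positions of w, counting its first letter as i.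
DESFrom : ℕ → Word → List ℕ
DESFrom i []          = []
DESFrom i (x ∷ [])    = []
DESFrom i (x ∷ y ∷ w) =
  if does (y <? x) then i ∷ DESFrom (suc i) (y ∷ w) else DESFrom (suc i) (y ∷ w)

DES : Word → List ℕ
DES = DESFrom 1

maj : Word → ℕ
maj w = sum (DES w)

ZeroFrom : ℕ → Word → List ℕ
ZeroFrom i []      = []
ZeroFrom i (x ∷ w) =
  if does (x ≟ 0) then i ∷ ZeroFrom (suc i) w else ZeroFrom (suc i) w

Zero : Word → List ℕ
Zero = ZeroFrom 1

#zero : Word → ℕ
#zero w = length (Zero w)

Pos : Word → Word
Pos = filter (0 <?_)

-- Integer-valued, so that the difference is not truncated.
mafz : Word → ℤ
mafz w = (+ sum (Zero w) -ᶻ + sum (map suc (upTo (#zero w)))) +ᶻ + maj (Pos w)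

-- Membership in Sh(0ⁿ⁻ᵐ v), where m = length v; meaningful for m ≤ n only.
Sh : ℕ → Word → Word → Set
Sh n v w = length w ≡ n × #zero w ≡ n ∸ length v × Pos w ≡ v

-- Either a word consists of zeros only, or it is uniquely w′ a 0ʳ with a positive;
-- the letter a is stored as its predecessor.
data LastPositive : Word → Set where
  zeros : ∀ r → LastPositive (replicate r 0)
  split : ∀ w′ a r → LastPositive (w′ ++ suc a ∷ replicate r 0)

lastPositive : ∀ w → LastPositive w
lastPositive []      = zeros 0
lastPositive (x ∷ w) with lastPositive w
lastPositive (x ∷ _)     | split w′ a r = split (x ∷ w′) a r
lastPositive (zero ∷ _)  | zeros r      = zeros (suc r)
lastPositive (suc a ∷ _) | zeros r      = split [] a r

-- The value at [] is junk.
dropLast : Word → Word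
dropLast w with initLast w
... | []      = []
... | w″ ∷ʳ′ c = w″

-- δ scans the word from the left; m counts the zeros read since the last positive
-- letter.  Those zeros are put back right after the next positive letter.  The first
-- clause is only relevant, with m ≥ 1, for words ending in 0, on which δ is never used.
δFrom : ℕ → Word → Word
δFrom m []          = replicate m 0
δFrom m (zero ∷ w)  = δFrom (suc m) w
δFrom m (suc x ∷ w) = suc x ∷ replicate m 0 ++ δFrom 0 w

δ : Word → Word
δ = δFrom 0

-- F₃ (u b), computed from the shape of u, the word F₃ u and the letter b.
F₃-step : ∀ {u} → LastPositive u → Word → ℕ → Word
F₃-step {u} (zeros _)         F₃u b = u ∷ʳ b
F₃-step (split w′ a (suc r)) F₃u b =
  if does (suc a ≤? b) then F₃u ∷ʳ b else 0 ∷ dropLast F₃u ∷ʳ b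
F₃-step (split w′ a zero)    F₃u b =
  if does (suc a ≤? b) then F₃u ∷ʳ b else δ F₃u ∷ʳ b

F₃-rev : ∀ {w : Word} → Reverse w → Word
F₃-rev []            = []
F₃-rev (u ∶ ru ∶ʳ b) = F₃-step (lastPositive u) (F₃-rev ru) b

F₃ : Word → Word
F₃ w = F₃-rev (reverseView w)

-- The remaining lemmas confirm that δ and F₃ satisfy their usual defining equations.

δ-blocks : (bs : List (ℕ × ℕ × Word)) →
           All (λ (m , x , v) → 0 < x × All (0 <_) v) bs →
           δ (concatMap (λ (m , x , v) → replicate m 0 ++ x ∷ v) bs)
             ≡ concatMap (λ (m , x , v) → x ∷ replicate m 0 ++ v) bs
δ-blocks [] [] = refl
δ-blocks ((m , suc x , v) ∷ bs) ((_ , v>0) ∷ bs>0) =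
  trans (cong δ (++-assoc (replicate m 0) (suc x ∷ v) _))
  (trans (skip 0 m)
  (cong (suc x ∷_)
  (trans (cong₂ (λ k t → replicate k 0 ++ t) (+-identityʳ m)
           (trans (copy v v>0) (cong (v ++_) (δ-blocks bs bs>0))))
         (sym (++-assoc (replicate m 0) v _)))))
  where
  skip : ∀ {t} i k →
         δFrom i (replicate k 0 ++ suc x ∷ t) ≡ suc x ∷ replicate (k + i) 0 ++ δ t
  skip i zero = refl
  skip {t} i (suc k) =
    trans (skip (suc i) k) (cong (λ j → suc x ∷ replicate j 0 ++ δ t) (+-suc k i))
  copy : ∀ {t} u → All (0 <_) u → δ (u ++ t) ≡ u ++ δ t
  copy [] [] = refl
  copy (suc y ∷ u) (_ ∷ u>0) = cong (suc y ∷_) (copy u u>0)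

lastPositive-zeros : ∀ r → lastPositive (replicate r 0) ≡ zeros r
lastPositive-zeros zero = refl
lastPositive-zeros (suc r) rewrite lastPositive-zeros r = refl

lastPositive-split : ∀ w′ a r →
                     lastPositive (w′ ++ suc a ∷ replicate r 0) ≡ split w′ a r
lastPositive-split [] a r rewrite lastPositive-zeros r = refl
lastPositive-split (x ∷ w′) a r rewrite lastPositive-split w′ a r = refl

dropLast-∷ʳ : ∀ w c → dropLast (w ∷ʳ c) ≡ w
dropLast-∷ʳ w c = unique (initLast (w ∷ʳ c)) refl
  where
  unique : ∀ {u} → InitLast u → u ≡ w ∷ʳ c → dropLast u ≡ w
  unique {u} _ e with initLast u
  unique _ e | [] = empty w e
    where
    empty : ∀ w → [] ≡ w ∷ʳ c → [] ≡ w
    empty [] ()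
    empty (_ ∷ _) ()
  unique _ e | w″ ∷ʳ′ _ with refl , _ ← ∷ʳ-injective w″ w e = refl

F₃-rev-unique : ∀ {w w′ : Word} (p : Reverse w) (q : Reverse w′) → w ≡ w′ → F₃-rev p ≡ F₃-rev q
F₃-rev-unique [] [] _ = refl
F₃-rev-unique [] ([] ∶ _ ∶ʳ _) ()
F₃-rev-unique [] ((_ ∷ _) ∶ _ ∶ʳ _) ()
F₃-rev-unique ([] ∶ _ ∶ʳ _) [] ()
F₃-rev-unique ((_ ∷ _) ∶ _ ∶ʳ _) [] ()
F₃-rev-unique (u ∶ p ∶ʳ b) (u′ ∶ q ∶ʳ b′) e with refl , refl ← ∷ʳ-injective u u′ e =
  cong (λ z → F₃-step (lastPositive u) z b) (F₃-rev-unique p q refl)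

F₃-∷ʳ : ∀ u b {p} → lastPositive u ≡ p → F₃ (u ∷ʳ b) ≡ F₃-step p (F₃ u) b
F₃-∷ʳ u b refl = F₃-rev-unique (reverseView (u ∷ʳ b)) (u ∶ reverseView u ∶ʳ b) refl

F₃-[] : F₃ [] ≡ []
F₃-[] = refl

F₃-zeros : ∀ r b → F₃ (replicate r 0 ∷ʳ b) ≡ replicate r 0 ∷ʳ b
F₃-zeros r b = F₃-∷ʳ (replicate r 0) b (lastPositive-zeros r)

F₃-case₁ : ∀ w′ {a} r b → 0 < a → a ≤ b →
           F₃ ((w′ ++ a ∷ replicate r 0) ∷ʳ b) ≡ F₃ (w′ ++ a ∷ replicate r 0) ∷ʳ b
F₃-case₁ w′ {suc a} r b _ a≤b =
  trans (F₃-∷ʳ (w′ ++ suc a ∷ replicate r 0) b (lastPositive-split w′ a r)) (step r)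
  where
  step : ∀ r {x} → F₃-step (split w′ a r) x b ≡ x ∷ʳ b
  step zero    rewrite dec-true (suc a ≤? b) a≤b = refl
  step (suc r) rewrite dec-true (suc a ≤? b) a≤b = refl

F₃-case₂ : ∀ w′ {a} r b → b < a → ∀ w″ c →
           F₃ (w′ ++ a ∷ replicate (suc r) 0) ≡ w″ ∷ʳ c →
           F₃ ((w′ ++ a ∷ replicate (suc r) 0) ∷ʳ b) ≡ 0 ∷ w″ ∷ʳ b
F₃-case₂ w′ {suc a} r b b<a w″ c e =
  trans (F₃-∷ʳ (w′ ++ suc a ∷ replicate (suc r) 0) b (lastPositive-split w′ a (suc r)))
        (step e)
  where
  step : ∀ {x} → x ≡ w″ ∷ʳ c → F₃-step (split w′ a (suc r)) x b ≡ 0 ∷ w″ ∷ʳ b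
  step refl rewrite dec-false (suc a ≤? b) (<⇒≱ b<a) | dropLast-∷ʳ w″ c = refl

F₃-case₃ : ∀ w′ {a} b → b < a →
           F₃ ((w′ ++ a ∷ []) ∷ʳ b) ≡ δ (F₃ (w′ ++ a ∷ [])) ∷ʳ b
F₃-case₃ w′ {suc a} b b<a =
  trans (F₃-∷ʳ (w′ ++ suc a ∷ []) b (lastPositive-split w′ a 0)) step
  where
  step : ∀ {x} → F₃-step (split w′ a 0) x b ≡ δ x ∷ʳ b
  step rewrite dec-false (suc a ≤? b) (<⇒≱ b<a) = refl

{-# OPTIONS --safe #-}
-- F₃ (u b) is y b for every y with back b y = F₃ u, where the map back b does not involve u:
-- it fixes y if the last positive letter of y, if any, is at most b, and otherwise it undoes
-- the rotation w 0 ↦ 0 w or the map δ, according to the first letter of y.  As back b is onto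
-- and preserves lengths and positive subwords, F₃ is bijective on each shuffle class.
-- In mafz every zero contributes the number of positive letters to its left; hence appending
-- b to y increases mafz by the same amount as appending b to u increases maj.
module Submission where

open import Defs
open import Data.Bool.Base using (true; false; if_then_else_)
open import Data.Empty using (⊥-elim)
open import Data.Integer.Base using (+_) renaming (_+_ to _+ᶻ_; _-_ to _-ᶻ_; -_ to -ᶻ_)
import Data.Integer.Properties as ℤ
open import Data.List.Base
  using ([]; _∷_; _∷ʳ_; _++_; length; last; replicate; map; upTo; applyUpTo; initLast; _∷ʳ′_)
open import Data.List.Properties
  using (filter-++; length-++; ++-identityʳ; ∷ʳ-injective; map-upTo)
open import Data.List.Relation.Unary.All using (All)
open import Data.List.Reverse using (Reverse; []; _∶_∶ʳ_; reverseView)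
open import Data.Maybe.Base using (fromMaybe)
open import Data.Nat.Base using (ℕ; zero; suc; _+_; _≤_; _<_; z≤n; s≤s)
open import Data.Nat.ListAction using (sum)
open import Data.Nat.Properties
  using (_≤?_; _<?_; +-comm; +-assoc; +-suc; +-identityʳ; +-cancelʳ-≡; suc-injective;
         ≤-refl; ≤-trans; ≤⇒≯; <⇒≱; ≰⇒>; 1+n≢0)
open import Data.Nat.Tactic.RingSolver using (solve-∀)
open import Data.Product.Base using (Σ; ∃; _×_; _,_; proj₁; proj₂)
open import Function.Base using (_on_; _∘_)
open import Function.Definitions using (Bijective)
open import Relation.Binary.PropositionalEquality
  using (_≡_; _≢_; refl; sym; trans; cong; cong₂; subst; module ≡-Reasoning)
open import Relation.Nullary.Decidable using (does; yes; no; dec-true; dec-false)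

open ≡-Reasoning

-- Last letters and positive subwords.

-- Junk value 0 on words without (positive) letters.
end top : Word → ℕ
end = fromMaybe 0 ∘ last
top = end ∘ Pos

last-++ : ∀ (u : Word) c t → last (u ++ c ∷ t) ≡ last (c ∷ t)
last-++ []           c t = refl
last-++ (x ∷ [])     c t = refl
last-++ (x ∷ y ∷ u) c t = last-++ (y ∷ u) c t

end-++ : ∀ u c t → end (u ++ c ∷ t) ≡ end (c ∷ t)
end-++ u c t = cong (fromMaybe 0) (last-++ u c t)

length-∷ʳ : ∀ (u : Word) b → length (u ∷ʳ b) ≡ suc (length u)
length-∷ʳ u b = trans (length-++ u) (+-comm (length u) 1)

Pos-++ : ∀ u t → Pos (u ++ t) ≡ Pos u ++ Pos t
Pos-++ = filter-++ (0 <?_)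

Pos-replicate : ∀ r → Pos (replicate r 0) ≡ []
Pos-replicate zero    = refl
Pos-replicate (suc r) = Pos-replicate r

Pos-split : ∀ w a r → Pos (w ++ suc a ∷ replicate r 0) ≡ Pos w ∷ʳ suc a
Pos-split w a r =
  trans (Pos-++ w _) (cong (λ t → Pos w ++ suc a ∷ t) (Pos-replicate r))

end-replicate : ∀ r → end (replicate r 0) ≡ 0
end-replicate zero          = refl
end-replicate (suc zero)    = refl
end-replicate (suc (suc r)) = end-replicate (suc r)

top-replicate : ∀ r → top (replicate r 0) ≡ 0
top-replicate r = cong end (Pos-replicate r)

top-split : ∀ w a r → top (w ++ suc a ∷ replicate r 0) ≡ suc a
top-split w a r = trans (cong end (Pos-split w a r)) (end-++ (Pos w) (suc a) [])

end≤top : ∀ w → end w ≤ top w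
end≤top w with initLast w
... | []           = z≤n
... | u ∷ʳ′ zero   rewrite end-++ u 0 [] = z≤n
... | u ∷ʳ′ suc a rewrite end-++ u (suc a) [] | top-split u a 0 = ≤-refl

replicate-∷ʳ : ∀ r → replicate (suc r) 0 ≡ replicate r 0 ∷ʳ 0
replicate-∷ʳ zero    = refl
replicate-∷ʳ (suc r) = cong (0 ∷_) (replicate-∷ʳ r)

replicate-∷ : ∀ m (w : Word) → replicate m 0 ++ 0 ∷ w ≡ 0 ∷ replicate m 0 ++ w
replicate-∷ zero    w = refl
replicate-∷ (suc m) w = cong (0 ∷_) (replicate-∷ m w)

-- The inverse of `δ`.

-- The inverse of δ: δ (carry h w) ≡ suc h ∷ w.  Every positive letter moves to the end of
-- the run of zeros that follows it.
carry : ℕ → Word → Word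
carry h []          = suc h ∷ []
carry h (zero ∷ w)  = 0 ∷ carry h w
carry h (suc k ∷ w) = suc h ∷ carry k w

δFrom-carry : ∀ m h w → δFrom m (carry h w) ≡ suc h ∷ replicate m 0 ++ w
δFrom-carry m h []          = refl
δFrom-carry m h (zero ∷ w)  =
  trans (δFrom-carry (suc m) h w) (cong (suc h ∷_) (sym (replicate-∷ m w)))
δFrom-carry m h (suc k ∷ w) = cong (λ t → suc h ∷ replicate m 0 ++ t) (δFrom-carry 0 k w)

Pos-carry : ∀ h w → Pos (carry h w) ≡ suc h ∷ Pos w
Pos-carry h []          = refl
Pos-carry h (zero ∷ w)  = Pos-carry h w
Pos-carry h (suc k ∷ w) = cong (suc h ∷_) (Pos-carry k w)

length-carry : ∀ h w → length (carry h w) ≡ suc (length w)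
length-carry h []          = refl
length-carry h (zero ∷ w)  = cong suc (length-carry h w)
length-carry h (suc k ∷ w) = cong suc (length-carry k w)

-- The first positive letter of the target is the carried `suc h`. The target must end in a positive
-- letter, as every value of `carry` does.
carry-surjective : ∀ x a → ∃ λ h → ∃ λ w → carry h w ≡ x ∷ʳ suc a
carry-surjective []          a = a , [] , refl
carry-surjective (zero ∷ x)  a with h , w , eq ← carry-surjective x a =
  h , 0 ∷ w , cong (0 ∷_) eq
carry-surjective (suc c ∷ x) a with h , w , eq ← carry-surjective x a =
  c , suc h ∷ w , cong (suc c ∷_) eq

-- The last positive letter travels past all final zeros. So `carry` never ends in 0, whereas
-- undoing a rotation always does.
end-carry : ∀ h w → end (carry h w) ≡ top (suc h ∷ w)
end-carry h []          = refl
end-carry h (zero ∷ w)  = trans (end-∷ h w) (end-carry h w)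
  where
  end-∷ : ∀ h w → end (0 ∷ carry h w) ≡ end (carry h w)
  end-∷ h []          = refl
  end-∷ h (zero ∷ w)  = refl
  end-∷ h (suc l ∷ w) = refl
end-carry h (suc k ∷ w) = trans (end-∷ h k w) (end-carry k w)
  where
  end-∷ : ∀ h k w → end (suc h ∷ carry k w) ≡ end (carry k w)
  end-∷ h k []          = refl
  end-∷ h k (zero ∷ w)  = refl
  end-∷ h k (suc l ∷ w) = refl

-- The map `back` and its surjectivity.

unwind : Word → Word
unwind []          = []
unwind (zero ∷ w)  = w ∷ʳ 0
unwind (suc h ∷ w) = carry h w

back : ℕ → Word → Word
back b y = if does (top y ≤? b) then y else unwind y

back-≤ : ∀ {b} y → top y ≤ b → back b y ≡ y
back-≤ {b} y y≤b = cong (λ d → if d then y else unwind y) (dec-true (top y ≤? b) y≤b)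

back-> : ∀ {b} y → b < top y → back b y ≡ unwind y
back-> {b} y b<y = cong (λ d → if d then y else unwind y) (dec-false (top y ≤? b) (<⇒≱ b<y))

data BackView (b : ℕ) (y : Word) : Word → Set where
  keep : top y ≤ b → BackView b y y
  undo : b < top y → BackView b y (unwind y)

backView : ∀ b y → BackView b y (back b y)
backView b y with top y ≤? b
... | yes y≤b = subst (BackView b y) (sym (back-≤ y y≤b)) (keep y≤b)
... | no  y≰b = subst (BackView b y) (sym (back-> y (≰⇒> y≰b))) (undo (≰⇒> y≰b))

Pos-unwind : ∀ y → Pos (unwind y) ≡ Pos y
Pos-unwind []          = refl
Pos-unwind (zero ∷ w)  = trans (Pos-++ w (0 ∷ [])) (++-identityʳ (Pos w))
Pos-unwind (suc h ∷ w) = Pos-carry h w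

length-unwind : ∀ y → length (unwind y) ≡ length y
length-unwind []          = refl
length-unwind (zero ∷ w)  = length-∷ʳ w 0
length-unwind (suc h ∷ w) = length-carry h w

-- The last letter of `x` tells which move to invert: 0 comes from a rotation, a positive letter
-- from `carry`.
unwind-surjective : ∀ x → ∃ λ y → unwind y ≡ x
unwind-surjective x with initLast x
... | []          = [] , refl
... | w ∷ʳ′ zero  = 0 ∷ w , refl
... | w ∷ʳ′ suc a with h , w′ , eq ← carry-surjective w a = suc h ∷ w′ , eq

Pos-back : ∀ b y → Pos (back b y) ≡ Pos y
Pos-back b y with back b y | backView b y
... | _ | keep _ = refl
... | _ | undo _ = Pos-unwind y

length-back : ∀ b y → length (back b y) ≡ length y
length-back b y with back b y | backView b y
... | _ | keep _ = refl
... | _ | undo _ = length-unwind y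

-- `unwind` keeps the last positive letter, so a preimage of `x` under it falls in the same branch
-- of `back b` as `x`.
back-surjective : ∀ b x → ∃ λ y → back b y ≡ x
back-surjective b x with top x ≤? b
... | yes x≤b = x , back-≤ x x≤b
... | no  x≰b with y , refl ← unwind-surjective x =
  y , back-> y (subst (b <_) (cong end (Pos-unwind y)) (≰⇒> x≰b))

-- The recursion of `F₃` expressed through `back`.

F₃-replicate : ∀ r → F₃ (replicate r 0) ≡ replicate r 0
F₃-replicate zero    = refl
F₃-replicate (suc r) = subst (λ w → F₃ w ≡ w) (sym (replicate-∷ʳ r)) (F₃-zeros r 0)

-- The two invariants select the defining case: equal positive subwords make `back b` and `F₃`
-- compare the same letter with `b`, and equal last letters tie the first letter of `y` to whether
-- `u` ends in 0. They are hypotheses because their own induction uses this lemma.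
F₃-∷ʳ-back : ∀ u b y → Pos (F₃ u) ≡ Pos u → last (F₃ u) ≡ last u → back b y ≡ F₃ u →
             F₃ (u ∷ʳ b) ≡ y ∷ʳ b
F₃-∷ʳ-back u b y Pos≡ last≡ back≡ =
  step (lastPositive u) (backView b y) (cong (fromMaybe 0) last≡) back≡
    (cong end (trans (sym (Pos-back b y)) (trans (cong Pos back≡) Pos≡)))
  where
  step : ∀ {u x} → LastPositive u → BackView b y x → end (F₃ u) ≡ end u → x ≡ F₃ u →
         top y ≡ top u → F₃ (u ∷ʳ b) ≡ y ∷ʳ b
  step (zeros r) (keep _) _ eq _ =
    trans (F₃-zeros r b) (cong (_∷ʳ b) (sym (trans eq (F₃-replicate r))))
  -- Here `top y` takes its default value 0, which cannot exceed `b`.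
  step (zeros r) (undo b<y) _ _ top≡
    with () ← subst (b <_) (trans top≡ (top-replicate r)) b<y
  step (split w a r) (keep y≤b) _ eq top≡ =
    trans (F₃-case₁ w r b (s≤s z≤n) (subst (_≤ b) (trans top≡ (top-split w a r)) y≤b))
          (cong (_∷ʳ b) (sym eq))
  step (split w a r) (undo b<y) end≡ eq top≡ =
    descent y r end≡ eq (subst (b <_) top≡′ b<y) top≡′
    where
    top≡′ = trans top≡ (top-split w a r)
    descent : ∀ y r → end (F₃ (w ++ suc a ∷ replicate r 0)) ≡ end (w ++ suc a ∷ replicate r 0) →
              unwind y ≡ F₃ (w ++ suc a ∷ replicate r 0) → b < suc a → top y ≡ suc a →
              F₃ ((w ++ suc a ∷ replicate r 0) ∷ʳ b) ≡ y ∷ʳ b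
    descent (zero ∷ t) (suc r) _ eq b<a _ = F₃-case₂ w r b b<a t 0 (sym eq)
    descent (suc h ∷ t) zero _ eq b<a _ =
      trans (F₃-case₃ w b b<a)
        (cong (_∷ʳ b) (trans (cong δ (sym eq)) (δFrom-carry 0 h t)))
    -- Undoing a rotation leaves a final 0, but the last letter is `suc a`.
    descent (zero ∷ t) zero end≡ eq _ _ = ⊥-elim (1+n≢0 (begin
      suc a                    ≡⟨ sym (end-++ w (suc a) []) ⟩
      end (w ++ suc a ∷ [])    ≡⟨ sym end≡ ⟩
      end (F₃ (w ++ suc a ∷ [])) ≡⟨ cong end (sym eq) ⟩
      end (t ∷ʳ 0)             ≡⟨ end-++ t 0 [] ⟩
      0                        ∎))
    -- `carry` leaves a positive last letter, but the last letter is 0.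
    descent (suc h ∷ t) (suc r) end≡ eq _ top≡ = ⊥-elim (1+n≢0 (begin
      suc a                    ≡⟨ sym top≡ ⟩
      top (suc h ∷ t)          ≡⟨ sym (end-carry h t) ⟩
      end (carry h t)          ≡⟨ cong end eq ⟩
      end (F₃ (w ++ suc a ∷ replicate (suc r) 0)) ≡⟨ end≡ ⟩
      end (w ++ suc a ∷ replicate (suc r) 0)      ≡⟨ end-++ w (suc a) _ ⟩
      end (replicate (suc r) 0)                   ≡⟨ end-replicate (suc r) ⟩
      0                        ∎))

Pos-last-F₃ : ∀ {w} → Reverse w → Pos (F₃ w) ≡ Pos w × last (F₃ w) ≡ last w
Pos-last-F₃ [] = refl , refl
Pos-last-F₃ (u ∶ ru ∶ʳ b)
  with y , back≡ ← back-surjective b (F₃ u) | Pos≡ , last≡ ← Pos-last-F₃ ru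
  rewrite F₃-∷ʳ-back u b y Pos≡ last≡ back≡ =
  (begin
    Pos (y ∷ʳ b)          ≡⟨ Pos-++ y (b ∷ []) ⟩
    Pos y ++ Pos (b ∷ []) ≡⟨ cong (_++ Pos (b ∷ [])) (sym (Pos-back b y)) ⟩
    Pos (back b y) ++ Pos (b ∷ []) ≡⟨ cong (λ x → Pos x ++ Pos (b ∷ [])) back≡ ⟩
    Pos (F₃ u) ++ Pos (b ∷ []) ≡⟨ cong (_++ Pos (b ∷ [])) Pos≡ ⟩
    Pos u ++ Pos (b ∷ []) ≡⟨ sym (Pos-++ u (b ∷ [])) ⟩
    Pos (u ∷ʳ b)          ∎) ,
  trans (last-++ y b []) (sym (last-++ u b []))

Pos-F₃ : ∀ w → Pos (F₃ w) ≡ Pos w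
Pos-F₃ w = proj₁ (Pos-last-F₃ (reverseView w))

last-F₃ : ∀ w → last (F₃ w) ≡ last w
last-F₃ w = proj₂ (Pos-last-F₃ (reverseView w))

back⇒F₃ : ∀ u b y → back b y ≡ F₃ u → F₃ (u ∷ʳ b) ≡ y ∷ʳ b
back⇒F₃ u b y = F₃-∷ʳ-back u b y (Pos-F₃ u) (last-F₃ u)

F₃-∷ʳ-view : ∀ u b → ∃ λ y → back b y ≡ F₃ u × F₃ (u ∷ʳ b) ≡ y ∷ʳ b
F₃-∷ʳ-view u b with y , eq ← back-surjective b (F₃ u) = y , eq , back⇒F₃ u b y eq

-- Length and bijectivity of `F₃`.

length-F₃ : ∀ w → length (F₃ w) ≡ length w
length-F₃ w = go (reverseView w)
  where
  go : ∀ {w} → Reverse w → length (F₃ w) ≡ length w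
  go [] = refl
  go (u ∶ ru ∶ʳ b) with y , back≡ , F₃≡ ← F₃-∷ʳ-view u b = begin
    length (F₃ (u ∷ʳ b))   ≡⟨ cong length F₃≡ ⟩
    length (y ∷ʳ b)        ≡⟨ length-∷ʳ y b ⟩
    suc (length y)         ≡⟨ cong suc (sym (length-back b y)) ⟩
    suc (length (back b y)) ≡⟨ cong (suc ∘ length) back≡ ⟩
    suc (length (F₃ u))    ≡⟨ cong suc (go ru) ⟩
    suc (length u)         ≡⟨ sym (length-∷ʳ u b) ⟩
    length (u ∷ʳ b)        ∎

-- An image `y ∷ʳ b` determines the last letter `b` and, through `back b y`, the image of the
-- remaining prefix.
F₃-injective : ∀ w w′ → F₃ w ≡ F₃ w′ → w ≡ w′
F₃-injective w w′ = go (reverseView w) (reverseView w′)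
  where
  go : ∀ {w w′} → Reverse w → Reverse w′ → F₃ w ≡ F₃ w′ → w ≡ w′
  go []             []               eq = refl
  go []             (u′ ∶ _ ∶ʳ b′)   eq = ⊥-elim (1+n≢0 (sym (begin
    0                        ≡⟨ cong length eq ⟩
    length (F₃ (u′ ∷ʳ b′))   ≡⟨ length-F₃ (u′ ∷ʳ b′) ⟩
    length (u′ ∷ʳ b′)        ≡⟨ length-∷ʳ u′ b′ ⟩
    suc (length u′)          ∎)))
  go (u ∶ _ ∶ʳ b)   []               eq = ⊥-elim (1+n≢0 (begin
    suc (length u)       ≡⟨ sym (length-∷ʳ u b) ⟩
    length (u ∷ʳ b)      ≡⟨ sym (length-F₃ (u ∷ʳ b)) ⟩
    length (F₃ (u ∷ʳ b)) ≡⟨ cong length eq ⟩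
    0                    ∎))
  go (u ∶ ru ∶ʳ b)  (u′ ∶ ru′ ∶ʳ b′) eq
    with y , back≡ , F₃≡ ← F₃-∷ʳ-view u b | y′ , back≡′ , F₃≡′ ← F₃-∷ʳ-view u′ b′
    with refl , refl ← ∷ʳ-injective y y′ (trans (sym F₃≡) (trans eq F₃≡′)) =
    cong (_∷ʳ b) (go ru ru′ (trans (sym back≡) back≡′))

F₃-surjective : ∀ y → ∃ λ w → F₃ w ≡ y
F₃-surjective y = go (length y) y refl
  where
  -- The recursion is on the length, since `back b y` is in general no subword of `y ∷ʳ b`.
  go : ∀ n y → length y ≡ n → ∃ λ w → F₃ w ≡ y
  go n y eq with initLast y
  go n       _ eq | []      = [] , refl
  go zero    _ eq | y ∷ʳ′ b = ⊥-elim (1+n≢0 (trans (sym (length-∷ʳ y b)) eq))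
  go (suc n) _ eq | y ∷ʳ′ b
    with u , F₃≡ ← go n (back b y)
           (trans (length-back b y) (suc-injective (trans (sym (length-∷ʳ y b)) eq))) =
    u ∷ʳ b , back⇒F₃ u b y (sym F₃≡)

-- `mafz` as a natural number.

-- `p` is the number of positive letters already read. For `p = 0` this counts the pairs of a
-- positive letter and a later zero.
zeroWeight : ℕ → Word → ℕ
zeroWeight p []          = 0
zeroWeight p (zero ∷ w)  = p + zeroWeight p w
zeroWeight p (suc x ∷ w) = zeroWeight (suc p) w

mafzℕ : Word → ℕ
mafzℕ w = zeroWeight 0 w + maj (Pos w)

#zeroFrom+length-Pos : ∀ i w → length (ZeroFrom i w) + length (Pos w) ≡ length w
#zeroFrom+length-Pos i []          = refl
#zeroFrom+length-Pos i (zero ∷ w)  = cong suc (#zeroFrom+length-Pos (suc i) w)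
#zeroFrom+length-Pos i (suc x ∷ w) =
  trans (+-suc _ _) (cong suc (#zeroFrom+length-Pos (suc i) w))

-- The j-th zero, with p positive letters before it, is at position p + j.
sum-ZeroFrom : ∀ i p k f w → i ≡ p + suc k → (∀ j → f j ≡ suc k + j) →
               sum (ZeroFrom i w) ≡ zeroWeight p w + sum (applyUpTo f (length (ZeroFrom i w)))
sum-ZeroFrom i p k f []          i≡ f≡ = refl
sum-ZeroFrom i p k f (suc x ∷ w) i≡ f≡ = sum-ZeroFrom (suc i) (suc p) k f w (cong suc i≡) f≡
sum-ZeroFrom i p k f (zero ∷ w)  i≡ f≡ = begin
  i + sum (ZeroFrom (suc i) w)
    ≡⟨ cong₂ _+_ (trans i≡ (cong (_+_ p) (sym (trans (f≡ 0) (+-identityʳ (suc k))))))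
         (sum-ZeroFrom (suc i) p (suc k) (f ∘ suc) w
           (trans (cong suc i≡) (sym (+-suc p (suc k))))
           (λ j → trans (f≡ (suc j)) (+-suc (suc k) j))) ⟩
  (p + f 0) + (zeroWeight p w + S)
    ≡⟨ interchange p (f 0) (zeroWeight p w) S ⟩
  (p + zeroWeight p w) + (f 0 + S) ∎
  where
  S = sum (applyUpTo (f ∘ suc) (length (ZeroFrom (suc i) w)))
  interchange : ∀ a b c d → (a + b) + (c + d) ≡ (a + c) + (b + d)
  interchange = solve-∀

mafz≡mafzℕ : ∀ w → mafz w ≡ + mafzℕ w
mafz≡mafzℕ w = cong (_+ᶻ + maj (Pos w)) (begin
  + sum (Zero w) -ᶻ + T                  ≡⟨ cong (λ s → + s -ᶻ + T) sum≡ ⟩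
  (+ zeroWeight 0 w +ᶻ + T) -ᶻ + T       ≡⟨ ℤ.+-assoc (+ zeroWeight 0 w) (+ T) (-ᶻ + T) ⟩
  + zeroWeight 0 w +ᶻ (+ T -ᶻ + T)       ≡⟨ cong (+ zeroWeight 0 w +ᶻ_) (ℤ.+-inverseʳ (+ T)) ⟩
  + zeroWeight 0 w +ᶻ + 0                ≡⟨ ℤ.+-identityʳ (+ zeroWeight 0 w) ⟩
  + zeroWeight 0 w                       ∎)
  where
  T = sum (map suc (upTo (#zero w)))
  sum≡ : sum (Zero w) ≡ zeroWeight 0 w + T
  sum≡ = trans (sum-ZeroFrom 1 0 0 suc w refl (λ _ → refl))
    (cong (λ l → zeroWeight 0 w + sum l) (sym (map-upTo suc (#zero w))))

-- Growth of `maj` and `mafz` when a letter is appended.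

-- The contribution to `maj` of a possible descent from the end of `w` to an appended `b`. The
-- default `end [] = 0` gives no descent after the empty word.
drop : ℕ → Word → ℕ
drop b w = if does (b <? end w) then length w else 0

drop-≤ : ∀ b w → end w ≤ b → drop b w ≡ 0
drop-≤ b w w≤b =
  cong (λ d → if d then length w else 0) (dec-false (b <? end w) (≤⇒≯ w≤b))

drop-> : ∀ b w → b < end w → drop b w ≡ length w
drop-> b w b<w = cong (λ d → if d then length w else 0) (dec-true (b <? end w) b<w)

-- Positions start at `suc j`, so the last letter of a nonempty `w` is at `j + length w`.
sum-DESFrom-∷ʳ : ∀ j w b → sum (DESFrom (suc j) (w ∷ʳ b)) ≡
                 sum (DESFrom (suc j) w) + (if does (b <? end w) then j + length w else 0)
sum-DESFrom-∷ʳ j [] b = refl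
sum-DESFrom-∷ʳ j (x ∷ []) b with does (b <? x)
... | true  = trans (+-identityʳ (suc j)) (+-comm 1 j)
... | false = refl
sum-DESFrom-∷ʳ j (x ∷ y ∷ w) b =
  prepend (does (y <? x)) (DESFrom (suc (suc j)) (y ∷ w))
    (trans (sum-DESFrom-∷ʳ (suc j) (y ∷ w) b)
      (cong (λ k → sum (DESFrom (suc (suc j)) (y ∷ w)) + (if does (b <? end (y ∷ w)) then k else 0))
        (sym (+-suc j _))))
  where
  prepend : ∀ c l {l′ e} → sum l′ ≡ sum l + e →
            sum (if c then suc j ∷ l′ else l′) ≡ sum (if c then suc j ∷ l else l) + e
  prepend true  l eq = trans (cong (_+_ (suc j)) eq) (sym (+-assoc (suc j) _ _))
  prepend false l eq = eq

maj-∷ʳ : ∀ w b → maj (w ∷ʳ b) ≡ maj w + drop b w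
maj-∷ʳ = sum-DESFrom-∷ʳ 0

zeroWeight-∷ʳ0 : ∀ p w → zeroWeight p (w ∷ʳ 0) ≡ zeroWeight p w + (p + length (Pos w))
zeroWeight-∷ʳ0 p []          = refl
zeroWeight-∷ʳ0 p (zero ∷ w)  =
  trans (cong (_+_ p) (zeroWeight-∷ʳ0 p w)) (sym (+-assoc p _ _))
zeroWeight-∷ʳ0 p (suc x ∷ w) =
  trans (zeroWeight-∷ʳ0 (suc p) w) (cong (_+_ (zeroWeight (suc p) w)) (sym (+-suc p _)))

zeroWeight-∷ʳsuc : ∀ p w b → zeroWeight p (w ∷ʳ suc b) ≡ zeroWeight p w
zeroWeight-∷ʳsuc p []          b = refl
zeroWeight-∷ʳsuc p (zero ∷ w)  b = cong (_+_ p) (zeroWeight-∷ʳsuc p w b)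
zeroWeight-∷ʳsuc p (suc x ∷ w) b = zeroWeight-∷ʳsuc (suc p) w b

-- Moving a letter past the following zeros lowers the weight of each of them by one; the
-- number of zeros is written as a difference of lengths, moved to the other side.
zeroWeight-carry : ∀ p h w → zeroWeight p (carry h w) + length w ≡
                             zeroWeight (suc p) w + length (Pos w)
zeroWeight-carry p h []          = refl
zeroWeight-carry p h (zero ∷ w)  = begin
  (p + zeroWeight p (carry h w)) + suc (length w) ≡⟨ rearrange p _ (length w) ⟩
  suc p + (zeroWeight p (carry h w) + length w)   ≡⟨ cong (_+_ (suc p)) (zeroWeight-carry p h w) ⟩
  suc p + (zeroWeight (suc p) w + length (Pos w)) ≡⟨ sym (+-assoc (suc p) _ _) ⟩
  (suc p + zeroWeight (suc p) w) + length (Pos w) ∎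
  where
  rearrange : ∀ a b c → (a + b) + suc c ≡ suc a + (b + c)
  rearrange = solve-∀
zeroWeight-carry p h (suc k ∷ w) =
  trans (+-suc _ _) (trans (cong suc (zeroWeight-carry (suc p) k w)) (sym (+-suc _ _)))

drop-0-Pos : ∀ w → drop 0 (Pos w) ≡ length (Pos w)
drop-0-Pos w = go (lastPositive w)
  where
  go : ∀ {w} → LastPositive w → drop 0 (Pos w) ≡ length (Pos w)
  go (zeros r)     rewrite Pos-replicate r = refl
  go (split w a r) = drop-> 0 (Pos (w ++ suc a ∷ replicate r 0))
    (subst (0 <_) (sym (top-split w a r)) (s≤s z≤n))

-- A new 0 weighs as much as there are positive letters; a new positive letter only extends the
-- positive subword. Both gains are `drop b (Pos y)`, as 0 is below every positive letter.
mafzℕ-∷ʳ : ∀ y b → mafzℕ (y ∷ʳ b) ≡ mafzℕ y + drop b (Pos y)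
mafzℕ-∷ʳ y zero    = begin
  zeroWeight 0 (y ∷ʳ 0) + maj (Pos (y ∷ʳ 0))
    ≡⟨ cong₂ _+_ (zeroWeight-∷ʳ0 0 y)
         (cong maj (trans (Pos-++ y (0 ∷ [])) (++-identityʳ (Pos y)))) ⟩
  (zeroWeight 0 y + length (Pos y)) + maj (Pos y)
    ≡⟨ swapʳ (zeroWeight 0 y) _ _ ⟩
  mafzℕ y + length (Pos y)
    ≡⟨ cong (_+_ (mafzℕ y)) (sym (drop-0-Pos y)) ⟩
  mafzℕ y + drop 0 (Pos y) ∎
  where
  swapʳ : ∀ a b c → (a + b) + c ≡ (a + c) + b
  swapʳ = solve-∀
mafzℕ-∷ʳ y (suc b) = begin
  zeroWeight 0 (y ∷ʳ suc b) + maj (Pos (y ∷ʳ suc b))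
    ≡⟨ cong₂ _+_ (zeroWeight-∷ʳsuc 0 y b) (cong maj (Pos-++ y (suc b ∷ []))) ⟩
  zeroWeight 0 y + maj (Pos y ∷ʳ suc b)
    ≡⟨ cong (_+_ (zeroWeight 0 y)) (maj-∷ʳ (Pos y) (suc b)) ⟩
  zeroWeight 0 y + (maj (Pos y) + drop (suc b) (Pos y))
    ≡⟨ sym (+-assoc (zeroWeight 0 y) _ _) ⟩
  mafzℕ y + drop (suc b) (Pos y) ∎

-- Undoing a rotation moves a zero of weight 0 to the end, where it weighs `length (Pos y)` and
-- causes no descent. `carry` costs one unit per zero, and the descent at `length y` then repays the
-- zeros and adds the positive letters.
mafzℕ-unwind : ∀ b y → b < top y →
               mafzℕ y + length (Pos y) ≡ mafzℕ (unwind y) + drop b (unwind y)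
mafzℕ-unwind b (zero ∷ w)  b<y = begin
  mafzℕ w + length (Pos w)         ≡⟨ cong (_+_ (mafzℕ w)) (sym (drop-0-Pos w)) ⟩
  mafzℕ w + drop 0 (Pos w)         ≡⟨ sym (mafzℕ-∷ʳ w 0) ⟩
  mafzℕ (w ∷ʳ 0)                   ≡⟨ sym (+-identityʳ _) ⟩
  mafzℕ (w ∷ʳ 0) + 0
    ≡⟨ cong (_+_ (mafzℕ (w ∷ʳ 0)))
         (sym (drop-≤ b (w ∷ʳ 0) (subst (_≤ b) (sym (end-++ w 0 [])) z≤n))) ⟩
  mafzℕ (w ∷ʳ 0) + drop b (w ∷ʳ 0) ∎
mafzℕ-unwind b (suc h ∷ w) b<y = begin
  (zeroWeight 1 w + M) + suc (length (Pos w))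
    ≡⟨ rearrange (zeroWeight 1 w) M _ ⟩
  suc (zeroWeight 1 w + length (Pos w)) + M
    ≡⟨ cong (λ k → suc k + M) (sym (zeroWeight-carry 0 h w)) ⟩
  suc (zeroWeight 0 (carry h w) + length w) + M
    ≡⟨ sym (rearrange (zeroWeight 0 (carry h w)) M _) ⟩
  (zeroWeight 0 (carry h w) + M) + suc (length w)
    ≡⟨ cong₂ (λ v k → (zeroWeight 0 (carry h w) + maj v) + k) (sym (Pos-carry h w))
         (sym (trans (drop-> b (carry h w) (subst (b <_) (sym (end-carry h w)) b<y))
                     (length-carry h w))) ⟩
  mafzℕ (carry h w) + drop b (carry h w) ∎
  where
  M = maj (suc h ∷ Pos w)
  rearrange : ∀ a b c → (a + b) + suc c ≡ suc (a + c) + b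
  rearrange = solve-∀

mafzℕ-back : ∀ b y → mafzℕ (y ∷ʳ b) ≡ mafzℕ (back b y) + drop b (back b y)
mafzℕ-back b y = trans (mafzℕ-∷ʳ y b) increment
  where
  increment : mafzℕ y + drop b (Pos y) ≡ mafzℕ (back b y) + drop b (back b y)
  increment with back b y | backView b y
  -- Neither `y` nor `Pos y` ends in a letter above `b`, so both gains vanish.
  ... | _ | keep y≤b = cong (_+_ (mafzℕ y))
    (trans (drop-≤ b (Pos y) y≤b) (sym (drop-≤ b y (≤-trans (end≤top y) y≤b))))
  ... | _ | undo b<y =
    trans (cong (_+_ (mafzℕ y)) (drop-> b (Pos y) b<y)) (mafzℕ-unwind b y b<y)

-- The identity of statistics and the shuffle classes.

mafzℕ-F₃ : ∀ w → mafzℕ (F₃ w) ≡ maj w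
mafzℕ-F₃ w = go (reverseView w)
  where
  -- The gain depends only on the last letter and the length, both of which `F₃` preserves.
  drop-cong : ∀ b x y → last x ≡ last y → length x ≡ length y → drop b x ≡ drop b y
  drop-cong b _ _ = cong₂ (λ l k → if does (b <? fromMaybe 0 l) then k else 0)
  go : ∀ {w} → Reverse w → mafzℕ (F₃ w) ≡ maj w
  go [] = refl
  go (u ∶ ru ∶ʳ b) with y , back≡ , F₃≡ ← F₃-∷ʳ-view u b = begin
    mafzℕ (F₃ (u ∷ʳ b))                   ≡⟨ cong mafzℕ F₃≡ ⟩
    mafzℕ (y ∷ʳ b)                        ≡⟨ mafzℕ-back b y ⟩
    mafzℕ (back b y) + drop b (back b y)  ≡⟨ cong (λ x → mafzℕ x + drop b x) back≡ ⟩
    mafzℕ (F₃ u) + drop b (F₃ u)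
      ≡⟨ cong₂ _+_ (go ru) (drop-cong b (F₃ u) u (last-F₃ u) (length-F₃ u)) ⟩
    maj u + drop b u                      ≡⟨ sym (maj-∷ʳ u b) ⟩
    maj (u ∷ʳ b)                          ∎

#zero-F₃ : ∀ w → #zero (F₃ w) ≡ #zero w
#zero-F₃ w = +-cancelʳ-≡ (length (Pos w)) (#zero (F₃ w)) (#zero w) (begin
  #zero (F₃ w) + length (Pos w)      ≡⟨ cong (λ v → #zero (F₃ w) + length v) (sym (Pos-F₃ w)) ⟩
  #zero (F₃ w) + length (Pos (F₃ w)) ≡⟨ #zeroFrom+length-Pos 1 (F₃ w) ⟩
  length (F₃ w)                      ≡⟨ length-F₃ w ⟩
  length w                           ≡⟨ sym (#zeroFrom+length-Pos 1 w) ⟩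
  #zero w + length (Pos w)           ∎)

Sh-F₃⁺ : ∀ {n v} w → Sh n v w → Sh n v (F₃ w)
Sh-F₃⁺ w (l , z , p) = trans (length-F₃ w) l , trans (#zero-F₃ w) z , trans (Pos-F₃ w) p

-- The invariants of `F₃` also transfer membership backwards, which places a preimage found among
-- all words in the same class.
Sh-F₃⁻ : ∀ {n v} w → Sh n v (F₃ w) → Sh n v w
Sh-F₃⁻ w (l , z , p) =
  trans (sym (length-F₃ w)) l , trans (sym (#zero-F₃ w)) z , trans (sym (Pos-F₃ w)) p

theorem1p2 : (v : Word) → v ≢ [] → All (0 <_) v → (n : ℕ) → length v ≤ n →
    (Σ (∀ w → Sh n v w → Sh n v (F₃ w)) λ F₃-Sh →
    Bijective {A = ∃ (Sh n v)} {B = ∃ (Sh n v)} (_≡_ on proj₁) (_≡_ on proj₁)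
    (λ (w , w∈Sh) → F₃ w , F₃-Sh w w∈Sh))
    × (∀ w → Sh n v w → + maj w ≡ mafz (F₃ w) × last w ≡ last (F₃ w))
theorem1p2 v _ _ n _ = (Sh-F₃⁺ , F₃-injective _ _ , surjective) , statistics
  where
  surjective : (y : ∃ (Sh n v)) →
               ∃ λ (x : ∃ (Sh n v)) → {z : ∃ (Sh n v)} →
               proj₁ z ≡ proj₁ x → F₃ (proj₁ z) ≡ proj₁ y
  surjective (y , y∈Sh) with w , refl ← F₃-surjective y = (w , Sh-F₃⁻ w y∈Sh) , cong F₃
  statistics : ∀ w → Sh n v w → + maj w ≡ mafz (F₃ w) × last w ≡ last (F₃ w)
  statistics w _ =
    sym (trans (mafz≡mafzℕ (F₃ w)) (cong +_ (mafzℕ-F₃ w))) , sym (last-F₃ w)
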